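{- Let $a, b, c$ be three integers whose sum $a+b+c$, product $abc$, and sum of products taken two at a time $ab+bc+ca$ are all perfect squares. Then each of the three integers $a, b, c$ must be a sum of two squares of rational numbers, of which one may possibly be zero. Thus, in any solution, either exactly one of the integers $a, b, c$ is a square, or all three of them are squares, or none of them is a square.
   Context: A perfect square (or square) is the square of an integer. A "solution" means a triple of integers $a,b,c$ such that $a+b+c$, $ab+bc+ca$ and $abc$ are all perfect squares. -}

module Defs where

open import Data.Integer.Base as ℤ using (ℤ)
open import Data.Product.Base using (∃; ∃₂; _×_)
open import Data.Rational.Base as ℚ using (ℚ)
open import Data.Sum.Base using (_⊎_)
open import Relation.Binary.PropositionalEquality.Core using (_≡_)
open import Relation.Nullary.Negation.Core using (¬_)

IsSquare : ℤ → Set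
IsSquare n = ∃ λ (k : ℤ) → n ≡ k ℤ.* k

-- The rationals x and y are allowed to be zero; for n = 0 both must be.
IsSumOfTwoRationalSquares : ℤ → Set
IsSumOfTwoRationalSquares n =
  ∃₂ λ (x y : ℚ) → n ℚ./ 1 ≡ x ℚ.* x ℚ.+ y ℚ.* y

IsSolution : ℤ → ℤ → ℤ → Set
IsSolution a b c =
    IsSquare (a ℤ.+ b ℤ.+ c)
  × IsSquare (a ℤ.* b ℤ.+ b ℤ.* c ℤ.+ c ℤ.* a)
  × IsSquare (a ℤ.* b ℤ.* c)

ExactlyOne : Set → Set → Set → Set
ExactlyOne P Q R =
    (P × ¬ Q × ¬ R)
  ⊎ (¬ P × Q × ¬ R)
  ⊎ (¬ P × ¬ Q × R)

{-# OPTIONS --safe #-}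
-- The integers a, b, c are the roots of t³ − p²t² + q²t − r², so each root n satisfies
-- n (n² + q²) = (p n)² + r².  Multiplying by n² + q² and applying the two-squares identity
-- writes n (n² + q²)² as a sum of two integer squares.  For the last claim, two squares among
-- a, b, c force the third to be a square: divide abc by them, or use the other two symmetric
-- functions when one of them vanishes.
module Submission where

open import Defs
open import Data.Integer.Base using (ℤ; +_; +[1+_]; -[1+_]; 0ℤ; ∣_∣; _+_; _*_; _-_; NonZero; ≢-nonZero)
open import Data.Integer.Properties as ℤ using (_≟_)
open import Data.Integer.Tactic.RingSolver using (solve-∀)
open import Data.Nat.Base as ℕ using (ℕ; zero; suc; s≤s)
import Data.Nat.Properties as ℕ
import Data.Nat.Tactic.RingSolver as ℕ
open import Data.Nat.Coprimality using (Coprime; coprime-/gcd; coprime-divisor)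
open import Data.Nat.Divisibility using (divides; ∣-refl)
open import Data.Nat.DivMod using (m/n*n≡m)
open import Data.Nat.GCD using (gcd; gcd[m,n]∣m; gcd[m,n]∣n; gcd[m,n]≢0)
open import Data.Product.Base using (∃; _×_; _,_)
open import Data.Rational.Base as ℚ using (ℚ; 0ℚ; fromℚᵘ; toℚᵘ)
import Data.Rational.Properties as ℚ
open import Data.Rational.Unnormalised.Base as ℚᵘ using (ℚᵘ; mkℚᵘ; _≃_; *≡*)
import Data.Rational.Unnormalised.Properties as ℚᵘ
open import Data.Sum.Base using (_⊎_; inj₁; inj₂)
open import Function.Base using (_∘_)
open import Relation.Binary.PropositionalEquality
open import Relation.Nullary.Decidable.Core using (Dec; yes; no; map′)
open import Relation.Nullary.Negation.Core using (¬_; contradiction)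

-- Here `d` divides `r * r` and is coprime to `r`, so it divides `r`. Being then a common divisor of
-- the coprime pair, it equals 1.
coprime-square-quotient : ∀ {n d r} → Coprime d r → n ℕ.* (d ℕ.* d) ≡ r ℕ.* r → n ≡ r ℕ.* r
coprime-square-quotient {n} {d} {r} coprime eq = begin
  n                  ≡⟨ ℕ.*-identityʳ n ⟨
  n ℕ.* (1 ℕ.* 1)    ≡⟨ cong (λ x → n ℕ.* (x ℕ.* x)) d≡1 ⟨
  n ℕ.* (d ℕ.* d)    ≡⟨ eq ⟩
  r ℕ.* r            ∎
  where
  open ≡-Reasoning
  d≡1 : d ≡ 1
  d≡1 = coprime (∣-refl , coprime-divisor coprime
    (divides (n ℕ.* d) (trans (sym eq) (sym (ℕ.*-assoc n d d)))))

-- Dividing `d` and `r` by their gcd `g` reduces to the coprime case. The equation for the quotients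
-- follows by cancelling `g * g`.
square-quotientℕ : ∀ {n} d r .{{_ : ℕ.NonZero d}} →
  n ℕ.* (d ℕ.* d) ≡ r ℕ.* r → ∃ λ s → n ≡ s ℕ.* s
square-quotientℕ {n} d r eq = r′ , coprime-square-quotient (coprime-/gcd d r)
  (ℕ.*-cancelʳ-≡ _ _ (g ℕ.* g) {{ℕ.m*n≢0 g g}} (begin
    n ℕ.* (d′ ℕ.* d′) ℕ.* (g ℕ.* g)      ≡⟨ interchange n d′ g ⟩
    n ℕ.* (d′ ℕ.* g ℕ.* (d′ ℕ.* g))      ≡⟨ cong (λ x → n ℕ.* (x ℕ.* x)) (m/n*n≡m (gcd[m,n]∣m d r)) ⟩
    n ℕ.* (d ℕ.* d)                      ≡⟨ eq ⟩
    r ℕ.* r                              ≡⟨ cong (λ x → x ℕ.* x) (m/n*n≡m (gcd[m,n]∣n d r)) ⟨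
    r′ ℕ.* g ℕ.* (r′ ℕ.* g)              ≡⟨ ℕ.[m*n]*[o*p]≡[m*o]*[n*p] r′ g r′ g ⟩
    r′ ℕ.* r′ ℕ.* (g ℕ.* g)              ∎))
  where
  open ≡-Reasoning
  g : ℕ
  g = gcd d r
  instance
    g≢0 : ℕ.NonZero g
    g≢0 = ℕ.≢-nonZero (gcd[m,n]≢0 d r (inj₁ (ℕ.≢-nonZero⁻¹ d)))
  d′ r′ : ℕ
  d′ = d ℕ./ g
  r′ = r ℕ./ g
  interchange : ∀ n x y → n ℕ.* (x ℕ.* x) ℕ.* (y ℕ.* y) ≡ n ℕ.* (x ℕ.* y ℕ.* (x ℕ.* y))
  interchange = ℕ.solve-∀

square≡∣∣² : ∀ i → i * i ≡ + (∣ i ∣ ℕ.* ∣ i ∣)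
square≡∣∣² (+ n)    = sym (ℤ.pos-* n n)
square≡∣∣² -[1+ n ] = refl

square-of-abs : ∀ i → i * i ≡ + ∣ i ∣ * + ∣ i ∣
square-of-abs i = trans (square≡∣∣² i) (ℤ.pos-* ∣ i ∣ ∣ i ∣)

square-quotient : ∀ n d r .{{_ : NonZero d}} → n * (d * d) ≡ r * r → IsSquare n
square-quotient (+ n) d r eq with square-quotientℕ {n} ∣ d ∣ ∣ r ∣ (ℤ.+-injective (begin
    + (n ℕ.* (∣ d ∣ ℕ.* ∣ d ∣))   ≡⟨ ℤ.pos-* n _ ⟩
    + n * + (∣ d ∣ ℕ.* ∣ d ∣)     ≡⟨ cong (+ n *_) (square≡∣∣² d) ⟨
    + n * (d * d)                 ≡⟨ eq ⟩
    r * r                         ≡⟨ square≡∣∣² r ⟩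
    + (∣ r ∣ ℕ.* ∣ r ∣)           ∎))
  where open ≡-Reasoning
... | s , n≡s² = + s , trans (cong +_ n≡s²) (ℤ.pos-* s s)
-- A negative `n` would make a square negative. Splitting on the sign of `d` lets the left side
-- compute to a negative integer, which the absurd pattern refutes.
square-quotient -[1+ n ] +[1+ d ] r eq = contradiction (trans eq (square≡∣∣² r)) λ()
square-quotient -[1+ n ] -[1+ d ] r eq = contradiction (trans eq (square≡∣∣² r)) λ()

-- A root can be replaced by its absolute value, which is at most `∣ z ∣`, so a bounded search
-- decides. The search bound is strict, hence the `suc`. This decision makes the final case split
-- constructive.
isSquare? : ∀ z → Dec (IsSquare z)
isSquare? z = map′ (λ (k , _ , eq) → + k , eq)
  (λ (k , eq) → ∣ k ∣ , s≤s (bound k eq) , trans eq (square-of-abs k))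
  (ℕ.anyUpTo? (λ k → z ≟ + k * + k) (suc ∣ z ∣))
  where
  m≤m*m : ∀ m → m ℕ.≤ m ℕ.* m
  m≤m*m zero    = ℕ.z≤n
  m≤m*m (suc m) = ℕ.m≤m*n (suc m) (suc m)
  bound : ∀ k → z ≡ k * k → ∣ k ∣ ℕ.≤ ∣ z ∣
  bound k refl = subst (∣ k ∣ ℕ.≤_) (sym (ℤ.abs-* k k)) (m≤m*m ∣ k ∣)

sum²≡0⇒≡0 : ∀ i j → i * i + j * j ≡ 0ℤ → i ≡ 0ℤ
sum²≡0⇒≡0 i j eq = ℤ.∣i∣≡0⇒i≡0 (∣i∣≡0 (ℕ.m+n≡0⇒m≡0 (∣ i ∣ ℕ.* ∣ i ∣) (ℤ.+-injective
  (trans (sym (cong₂ _+_ (square≡∣∣² i) (square≡∣∣² j))) eq))))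
  where
  ∣i∣≡0 : ∣ i ∣ ℕ.* ∣ i ∣ ≡ 0 → ∣ i ∣ ≡ 0
  ∣i∣≡0 p with ℕ.m*n≡0⇒m≡0∨n≡0 ∣ i ∣ p
  ... | inj₁ q = q
  ... | inj₂ q = q

sum²-quotient : ∀ n x y d .{{_ : NonZero d}} →
  n * (d * d) ≡ x * x + y * y → IsSumOfTwoRationalSquares n
-- Only `d * d` occurs, and it computes to the same value for either sign.
sum²-quotient n x y -[1+ d ] eq = sum²-quotient n x y +[1+ d ] eq
sum²-quotient n x y D@(+[1+ d ]) eq =
  -- The witnesses are `x / d` and `y / d`. The equation is checked on unnormalised fractions, where
  -- it is a cross-multiplication free of gcds.
  X , Y , ℚ.toℚᵘ-injective (begin
    toℚᵘ (fromℚᵘ (mkℚᵘ n 0))                        ≈⟨ ℚ.toℚᵘ-fromℚᵘ _ ⟩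
    mkℚᵘ n 0                                        ≈⟨ *≡* cross ⟩
    x/d ℚᵘ.* x/d ℚᵘ.+ y/d ℚᵘ.* y/d                  ≈⟨ ℚᵘ.+-cong (sq x/d) (sq y/d) ⟨
    toℚᵘ (X ℚ.* X) ℚᵘ.+ toℚᵘ (Y ℚ.* Y)              ≈⟨ ℚ.toℚᵘ-homo-+ (X ℚ.* X) (Y ℚ.* Y) ⟨
    toℚᵘ (X ℚ.* X ℚ.+ Y ℚ.* Y)                      ∎)
  where
  open ℚᵘ.≃-Reasoning
  x/d y/d : ℚᵘ
  x/d = mkℚᵘ x d
  y/d = mkℚᵘ y d
  X Y : ℚ
  X = fromℚᵘ x/d
  Y = fromℚᵘ y/d
  sq : ∀ p → toℚᵘ (fromℚᵘ p ℚ.* fromℚᵘ p) ≃ p ℚᵘ.* p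
  sq p = ℚᵘ.≃-trans (ℚ.toℚᵘ-homo-* (fromℚᵘ p) (fromℚᵘ p))
    (ℚᵘ.*-cong (ℚ.toℚᵘ-fromℚᵘ p) (ℚ.toℚᵘ-fromℚᵘ p))
  regroup : ∀ n x y e → n * e ≡ x * x + y * y →
    n * (e * e) ≡ (x * x * e + y * y * e) * + 1
  regroup n x y e eq = trans (sym (ℤ.*-assoc n e e)) (trans (cong (_* e) eq) (expand x y e))
    where
    expand : ∀ x y e → (x * x + y * y) * e ≡ (x * x * e + y * y * e) * + 1
    expand = solve-∀
  -- Adding two fractions of denominator `D * D` yields denominator `D * D * (D * D)`, so the
  -- hypothesis is multiplied once more by `D * D`.
  cross : n * (D * D * (D * D)) ≡ (x * x * (D * D) + y * y * (D * D)) * + 1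
  cross = regroup n x y (D * D) eq

-- Cyclic symmetry carries results proved for one position to the other two.
isSolution-rotate : ∀ a b c → IsSolution a b c → IsSolution b c a
isSolution-rotate a b c ((p , s) , (q , t) , (r , u)) =
  (p , trans (sum a b c) s) , (q , trans (pairs a b c) t) , (r , trans (prod a b c) u)
  where
  sum : ∀ a b c → b + c + a ≡ a + b + c
  sum = solve-∀
  pairs : ∀ a b c → b * c + c * a + a * b ≡ a * b + b * c + c * a
  pairs = solve-∀
  prod : ∀ a b c → b * c * a ≡ a * b * c
  prod = solve-∀

-- This is the cubic with roots `a`, `b`, `c` evaluated at `a`, with its negative terms moved to the
-- right.
root-identity : ∀ a b c → a * (a * a + (a * b + b * c + c * a)) ≡ (a + b + c) * (a * a) + a * b * c
root-identity = solve-∀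

isSolution⇒sum² : ∀ a b c → IsSolution a b c → IsSumOfTwoRationalSquares a
isSolution⇒sum² a b c ((p , s) , (q , t) , (r , u)) with a * a + q * q ≟ 0ℤ
... | yes D≡0 = subst IsSumOfTwoRationalSquares (sym (sum²≡0⇒≡0 a q D≡0)) (0ℚ , 0ℚ , refl)
-- Up to sign, the two numbers are the real and imaginary parts of `(p a + r i)(a - q i)`.
... | no  D≢0 = sum²-quotient a (p * a * a + r * q) (p * a * q - r * a) (a * a + q * q)
  {{≢-nonZero D≢0}} (begin
    a * ((a * a + q * q) * (a * a + q * q))                   ≡⟨ ℤ.*-assoc a _ _ ⟨
    a * (a * a + q * q) * (a * a + q * q)                     ≡⟨ cong (_* (a * a + q * q)) root ⟩
    (p * p * (a * a) + r * r) * (a * a + q * q)               ≡⟨ two-squares p r a q ⟩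
    (p * a * a + r * q) * (p * a * a + r * q)
      + (p * a * q - r * a) * (p * a * q - r * a)             ∎)
  where
  open ≡-Reasoning
  root : a * (a * a + q * q) ≡ p * p * (a * a) + r * r
  root = begin
    a * (a * a + q * q)                            ≡⟨ cong (λ x → a * (a * a + x)) t ⟨
    a * (a * a + (a * b + b * c + c * a))          ≡⟨ root-identity a b c ⟩
    (a + b + c) * (a * a) + a * b * c              ≡⟨ cong₂ (λ x y → x * (a * a) + y) s u ⟩
    p * p * (a * a) + r * r                        ∎
  two-squares : ∀ p r a q → (p * p * (a * a) + r * r) * (a * a + q * q) ≡
    (p * a * a + r * q) * (p * a * a + r * q) + (p * a * q - r * a) * (p * a * q - r * a)
  two-squares = solve-∀

third-isSquare : ∀ {a b c} → IsSolution a b c → IsSquare a → IsSquare b → IsSquare c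
third-isSquare {c = c} ((p , s) , (q , t) , (r , u)) (k , refl) (l , refl)
  with k ≟ 0ℤ | l ≟ 0ℤ
... | yes refl | yes refl = p , trans (sym (ℤ.+-identityˡ c)) s
-- With one of the two squares zero, the sum of pairwise products collapses to `c` times the other.
... | yes refl | no  l≢0  = square-quotient c l q {{≢-nonZero l≢0}} (trans (identity c l) t)
  where
  identity : ∀ c l → c * (l * l) ≡ 0ℤ * 0ℤ * (l * l) + l * l * c + c * (0ℤ * 0ℤ)
  identity = solve-∀
... | no  k≢0  | yes refl = square-quotient c k q {{≢-nonZero k≢0}} (trans (identity c k) t)
  where
  identity : ∀ c k → c * (k * k) ≡ k * k * (0ℤ * 0ℤ) + 0ℤ * 0ℤ * c + c * (k * k)
  identity = solve-∀
... | no  k≢0  | no  l≢0  = square-quotient c (k * l) r {{kl≢0}} (trans (identity c k l) u)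
  where
  kl≢0 : NonZero (k * l)
  kl≢0 = ℤ.i*j≢0 k l {{≢-nonZero k≢0}} {{≢-nonZero l≢0}}
  identity : ∀ c k l → c * (k * l * (k * l)) ≡ k * k * (l * l) * c
  identity = solve-∀

-- Any two of the propositions imply the third, which rules out exactly two holding.
all-exactlyOne-or-none : ∀ {P Q R : Set} → Dec P → Dec Q → Dec R →
  (P → Q → R) → (Q → R → P) → (R → P → Q) →
  ExactlyOne P Q R ⊎ (P × Q × R) ⊎ (¬ P × ¬ Q × ¬ R)
all-exactlyOne-or-none (yes p) (yes q) _       f g h = inj₂ (inj₁ (p , q , f p q))
all-exactlyOne-or-none (yes p) (no ¬q) _       f g h = inj₁ (inj₁ (p , ¬q , λ r → ¬q (h r p)))
all-exactlyOne-or-none (no ¬p) (yes q) _       f g h = inj₁ (inj₂ (inj₁ (¬p , q , ¬p ∘ g q)))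
all-exactlyOne-or-none (no ¬p) (no ¬q) (yes r) f g h = inj₁ (inj₂ (inj₂ (¬p , ¬q , r)))
all-exactlyOne-or-none (no ¬p) (no ¬q) (no ¬r) f g h = inj₂ (inj₂ (¬p , ¬q , ¬r))

mainTheorem1 : ∀ (a b c : ℤ) → IsSolution a b c →
    (IsSumOfTwoRationalSquares a × IsSumOfTwoRationalSquares b × IsSumOfTwoRationalSquares c)
    × ( ExactlyOne (IsSquare a) (IsSquare b) (IsSquare c)
    ⊎ (IsSquare a × IsSquare b × IsSquare c)
    ⊎ (¬ IsSquare a × ¬ IsSquare b × ¬ IsSquare c))
mainTheorem1 a b c abc =
  (isSolution⇒sum² a b c abc , isSolution⇒sum² b c a bca , isSolution⇒sum² c a b cab) ,
  all-exactlyOne-or-none (isSquare? a) (isSquare? b) (isSquare? c)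
    (third-isSquare abc) (third-isSquare bca) (third-isSquare cab)
  where
  bca : IsSolution b c a
  bca = isSolution-rotate a b c abc
  cab : IsSolution c a b
  cab = isSolution-rotate b c a bca
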